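{- Let $S$ be a finite set. Let $\mathrm{Semimat}(S)$ be the set of semimatroids on the ground set $S$, and let $\mathrm{MatId}(S)$ be the set of pairs $(M,\mathcal{I})$ of a matroid $M$ on $S$ and a modular ideal $\mathcal{I}$ of $M$. For a semimatroid $(S,\mathcal{C},r_{\mathcal{C}})$ let $M_{\mathcal{C}}=(S,r)$ with $r(X)=\max\{r_{\mathcal{C}}(Y) \mid Y\subseteq X,\ Y\in\mathcal{C}\}$ for all $X\subseteq S$. For $(M,\mathcal{I})\in \mathrm{MatId}(S)$ let $r_{\mathcal{I}}$ be the restriction of the rank function of $M$ to $\mathcal{I}$. Then: 1. The assignment $(S,\mathcal{C},r_{\mathcal{C}})\mapsto (M_{\mathcal{C}},\mathcal{C})$ is a map $\mathrm{Semimat}(S)\to\mathrm{MatId}(S)$ (that is, $r$ is the rank function of a matroid $M_{\mathcal{C}}$ on $S$, and $\mathcal{C}$ is a modular ideal of $M_{\mathcal{C}}$). 2. The assignment $(M,\mathcal{I})\mapsto (S,\mathcal{I},r_{\mathcal{I}})$ is a map $\mathrm{MatId}(S)\to\mathrm{Semimat}(S)$ (that is, $(S,\mathcal{I},r_{\mathcal{I}})$ is a semimatroid). 3. The two maps above are inverses of each other, and give a one-to-one correspondence between $\mathrm{Semimat}(S)$ and $\mathrm{MatId}(S)$.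
   Context: $\mathbb{N}$ includes $0$. A simplicial complex on a finite set $S$ is a family of subsets of $S$ closed under taking subsets; singletons $\{x\}$ with $x \in S$ need not belong to it. A semimatroid is a triple $(S,\mathcal{C},r_{\mathcal{C}})$ consisting of a finite set $S$ (ground set), a non-empty simplicial complex $\mathcal{C}$ on $S$ (the central sets), and a function $r_{\mathcal{C}}:\mathcal{C}\to\mathbb{N}$ (rank function) such that: (R1) if $X\in\mathcal{C}$ then $0\le r_{\mathcal{C}}(X)\le |X|$; (R2) if $X,Y\in\mathcal{C}$ and $X\subseteq Y$ then $r_{\mathcal{C}}(X)\le r_{\mathcal{C}}(Y)$; (R3) if $X,Y\in\mathcal{C}$ and $X\cup Y\in\mathcal{C}$ then $r_{\mathcal{C}}(X)+r_{\mathcal{C}}(Y)\ge r_{\mathcal{C}}(X\cup Y)+r_{\mathcal{C}}(X\cap Y)$; (CR1) if $X,Y\in\mathcal{C}$ and $r_{\mathcal{C}}(X)=r_{\mathcal{C}}(X\cap Y)$ then $X\cup Y\in\mathcal{C}$; (CR2) if $X,Y\in\mathcal{C}$ and $r_{\mathcal{C}}(X)<r_{\mathcal{C}}(Y)$ then $X\cup\{y\}\in\mathcal{C}$ for some $y\in Y-X$. A matroid $M=(S,r)$ is given by a finite set $S$ and its rank function $r:2^S\to\mathbb{N}$. A pair $\{X,Y\}$ of subsets of $S$ is a modular pair of $M$ if $r(X)+r(Y)=r(X\cup Y)+r(X\cap Y)$. A modular ideal $\mathcal{I}$ of $M$ is a non-empty collection of subsets of $S$ such that: (MI1) $\mathcal{I}$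 is a simplicial complex; (MI2) $\{a\}\in\mathcal{I}$ for every non-loop $a$ of $M$; (MI3) if $\{X,Y\}$ is a modular pair in $M$ and $X,Y\in\mathcal{I}$, then $X\cup Y\in\mathcal{I}$. -}

module Defs where

open import Data.Bool using (Bool; T; T?)
open import Data.Bool.Properties using (T-irrelevant)
open import Data.Fin using (Fin)
open import Data.Fin.Subset
  using (Subset; inside; outside; ⁅_⁆; _∈_; _⊆_; _∪_; _∩_; _─_; ∣_∣)
  renaming (⊥ to ∅)
open import Data.Fin.Subset.Properties using (_⊆?_; ⊥⊆; ∣⊥∣≡0)
open import Data.List using (List; []; _∷_; _++_; map; mapMaybe)
open import Data.List.Extrema.Nat using (max; argmax-all; v≤max⁺)
open import Data.List.Membership.Propositional using (lose) renaming (_∈_ to _∈ˡ_)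
open import Data.List.Membership.Propositional.Properties
  using (∈-map⁺; ∈-++⁺ˡ; ∈-++⁺ʳ)
import Data.List.Relation.Unary.All as All
import Data.List.Relation.Unary.All.Properties as All
import Data.List.Relation.Unary.Any.Properties as Any
open import Data.List.Relation.Unary.Any using (here)
open import Data.Maybe using (Maybe; just; nothing)
import Data.Maybe.Relation.Unary.All as MAll
import Data.Maybe.Relation.Unary.Any as MAny
open import Data.Nat using (ℕ; zero; suc; _+_; _≤_; _≥_; _<_)
open import Data.Nat.Properties using (≤-reflexive; ≤-trans; n≤0⇒n≡0)
open import Data.Product using (_×_; _,_; Σ-syntax; ∃-syntax; proj₂)
open import Data.Sum using (inj₂)
open import Data.Vec using ([]; _∷_)
open import Relation.Binary using (IsEquivalence)
open import Relation.Binary.PropositionalEquality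
  using (_≡_; refl; sym; trans; cong; subst)
open import Relation.Nullary using (yes; no; ¬_; contradiction; _×-dec_)

-- The ground set is S = Fin n throughout, and 2^S is Subset n.

private
  variable
    n : ℕ

-- A family of subsets of S is given by its characteristic function; classically
-- this is no restriction, and it makes X ∈ᶠ F a proposition.
Family : ℕ → Set
Family n = Subset n → Bool

infix 4 _∈ᶠ_

_∈ᶠ_ : Subset n → Family n → Set
X ∈ᶠ F = T (F X)

NonEmpty : Family n → Set
NonEmpty F = ∃[ X ] X ∈ᶠ F

IsSimplicialComplex : Family n → Set
IsSimplicialComplex F = ∀ {X Y} → X ⊆ Y → Y ∈ᶠ F → X ∈ᶠ F

-- A function F → ℕ.  By T-irrelevant its value at X does not depend on the
-- proof of X ∈ᶠ F.
RankOn : Family n → Set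
RankOn F = ∀ X → X ∈ᶠ F → ℕ

record IsSemimatroid {n : ℕ} (C : Family n) (r : RankOn C) : Set where
  field
    nonEmpty          : NonEmpty C
    simplicialComplex : IsSimplicialComplex C
    -- The bound 0 ≤ r X is built into the type ℕ.
    R1  : ∀ {X} (x : X ∈ᶠ C) → r X x ≤ ∣ X ∣
    R2  : ∀ {X Y} (x : X ∈ᶠ C) (y : Y ∈ᶠ C) → X ⊆ Y → r X x ≤ r Y y
    -- X ∩ Y always lies in C, so quantifying over its membership proof adds no
    -- hypothesis; likewise in CR1.
    R3  : ∀ {X Y} (x : X ∈ᶠ C) (y : Y ∈ᶠ C)
          (u : X ∪ Y ∈ᶠ C) (i : X ∩ Y ∈ᶠ C) →
          r X x + r Y y ≥ r (X ∪ Y) u + r (X ∩ Y) i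
    CR1 : ∀ {X Y} (x : X ∈ᶠ C) (y : Y ∈ᶠ C) (i : X ∩ Y ∈ᶠ C) →
          r X x ≡ r (X ∩ Y) i → X ∪ Y ∈ᶠ C
    CR2 : ∀ {X Y} (x : X ∈ᶠ C) (y : Y ∈ᶠ C) → r X x < r Y y →
          ∃[ e ] (e ∈ Y ─ X × X ∪ ⁅ e ⁆ ∈ᶠ C)

record Semimatroid (n : ℕ) : Set where
  constructor mkSemimatroid
  field
    central       : Family n
    rank          : RankOn central
    isSemimatroid : IsSemimatroid central rank
  open IsSemimatroid isSemimatroid public

record IsMatroidRank {n : ℕ} (r : Subset n → ℕ) : Set where
  field
    bounded    : ∀ X → r X ≤ ∣ X ∣
    monotone   : ∀ {X Y} → X ⊆ Y → r X ≤ r Y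
    submodular : ∀ X Y → r X + r Y ≥ r (X ∪ Y) + r (X ∩ Y)

record Matroid (n : ℕ) : Set where
  constructor mkMatroid
  field
    rank          : Subset n → ℕ
    isMatroidRank : IsMatroidRank rank
  open IsMatroidRank isMatroidRank public

module _ {n : ℕ} (M : Matroid n) where
  open Matroid M

  IsLoop : Fin n → Set
  IsLoop a = rank ⁅ a ⁆ ≡ 0

  IsModularPair : Subset n → Subset n → Set
  IsModularPair X Y = rank X + rank Y ≡ rank (X ∪ Y) + rank (X ∩ Y)

  record IsModularIdeal (I : Family n) : Set where
    field
      nonEmpty : NonEmpty I
      MI1 : IsSimplicialComplex I
      MI2 : ∀ {a} → ¬ IsLoop a → ⁅ a ⁆ ∈ᶠ I
      MI3 : ∀ {X Y} → IsModularPair X Y → X ∈ᶠ I → Y ∈ᶠ I → X ∪ Y ∈ᶠ I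

record MatId (n : ℕ) : Set where
  constructor mkMatId
  field
    matroid        : Matroid n
    ideal          : Family n
    isModularIdeal : IsModularIdeal matroid ideal

-- Equality of the underlying data, which is the set-theoretic equality of
-- triples (S , C , r) and of pairs (M , I): functions are compared pointwise
-- and proofs of the axioms are ignored.

infix 4 _≈ˢ_ _≈ᵐ_

record _≈ˢ_ {n : ℕ} (A B : Semimatroid n) : Set where
  private
    module A = Semimatroid A
    module B = Semimatroid B
  field
    central≡ : ∀ X → A.central X ≡ B.central X
    rank≡    : ∀ X (a : X ∈ᶠ A.central) (b : X ∈ᶠ B.central) →
               A.rank X a ≡ B.rank X b

record _≈ᵐ_ {n : ℕ} (P Q : MatId n) : Set where
  private
    module P = MatId P
    module Q = MatId Q
  field
    rank≡  : ∀ X → Matroid.rank P.matroid X ≡ Matroid.rank Q.matroid X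
    ideal≡ : ∀ X → P.ideal X ≡ Q.ideal X

≈ˢ-isEquivalence : IsEquivalence (_≈ˢ_ {n})
≈ˢ-isEquivalence = record
  { refl  = λ {A} → record
      { central≡ = λ _ → refl
      ; rank≡    = λ X a b → cong (Semimatroid.rank A X) (T-irrelevant a b) }
  ; sym   = λ p → record
      { central≡ = λ X → sym (central≡ p X)
      ; rank≡    = λ X a b → sym (rank≡ p X b a) }
  ; trans = λ p q → record
      { central≡ = λ X → trans (central≡ p X) (central≡ q X)
      ; rank≡    = λ X a c → let b = subst T (central≡ p X) a in
                   trans (rank≡ p X a b) (rank≡ q X b c) }
  }
  where open _≈ˢ_

≈ᵐ-isEquivalence : IsEquivalence (_≈ᵐ_ {n})
≈ᵐ-isEquivalence = record
  { refl  = record { rank≡ = λ _ → refl ; ideal≡ = λ _ → refl }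
  ; sym   = λ p → record
      { rank≡  = λ X → sym (rank≡ p X)
      ; ideal≡ = λ X → sym (ideal≡ p X) }
  ; trans = λ p q → record
      { rank≡  = λ X → trans (rank≡ p X) (rank≡ q X)
      ; ideal≡ = λ X → trans (ideal≡ p X) (ideal≡ q X) }
  }
  where open _≈ᵐ_

subsets : ∀ n → List (Subset n)
subsets zero    = [] ∷ []
subsets (suc n) = map (outside ∷_) (subsets n) ++ map (inside ∷_) (subsets n)

∈-subsets : (X : Subset n) → X ∈ˡ subsets n
∈-subsets []            = here refl
∈-subsets (outside ∷ X) = ∈-++⁺ˡ (∈-map⁺ (outside ∷_) (∈-subsets X))
∈-subsets {suc n} (inside ∷ X) =
  ∈-++⁺ʳ (map (outside ∷_) (subsets n)) (∈-map⁺ (inside ∷_) (∈-subsets X))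

module _ {n : ℕ} (A : Semimatroid n) where
  open Semimatroid A

  rankWithin : Subset n → Subset n → Maybe ℕ
  rankWithin X Y with T? (central Y) ×-dec (Y ⊆? X)
  ... | yes (y , _) = just (rank Y y)
  ... | no  _       = nothing

  -- The values rank Y for central Y ⊆ X.
  ranksWithin : Subset n → List ℕ
  ranksWithin X = mapMaybe (rankWithin X) (subsets n)

  -- The default 0 is harmless: it is never above the maximum, and the list is
  -- non-empty because ∅ is central (see maxRank-isMaximum).
  maxRank : Subset n → ℕ
  maxRank X = max 0 (ranksWithin X)

  IsRankWithin : Subset n → ℕ → Set
  IsRankWithin X k = ∃[ Y ] Σ[ y ∈ Y ∈ᶠ central ] (Y ⊆ X × k ≡ rank Y y)

  maxRank-isMaximum : ∀ X →
    IsRankWithin X (maxRank X) × (∀ k → IsRankWithin X k → k ≤ maxRank X)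
  maxRank-isMaximum X = attained , upper
    where
    sound : ∀ Y → MAll.All (IsRankWithin X) (rankWithin X Y)
    sound Y with T? (central Y) ×-dec (Y ⊆? X)
    ... | yes (y , Y⊆X) = MAll.just (Y , y , Y⊆X , refl)
    ... | no  _         = MAll.nothing

    attained : IsRankWithin X (maxRank X)
    attained = argmax-all (λ k → k) {P = IsRankWithin X}
      (∅ , ∅∈ , ⊥⊆ , sym (n≤0⇒n≡0 (≤-trans (R1 ∅∈) (≤-reflexive (∣⊥∣≡0 n)))))
      (All.mapMaybe⁺ (All.map⁺ (All.universal sound (subsets n))))
      where
      ∅∈ : ∅ ∈ᶠ central
      ∅∈ = simplicialComplex ⊥⊆ (proj₂ nonEmpty)

    complete : ∀ {Y} (y : Y ∈ᶠ central) → Y ⊆ X →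
               MAny.Any (rank Y y ≤_) (rankWithin X Y)
    complete {Y} y Y⊆X with T? (central Y) ×-dec (Y ⊆? X)
    ... | yes (y′ , _) = MAny.just (≤-reflexive (cong (rank Y) (T-irrelevant y y′)))
    ... | no  ¬p       = contradiction (y , λ {x} → Y⊆X {x}) ¬p

    upper : ∀ k → IsRankWithin X k → k ≤ maxRank X
    upper _ (Y , y , Y⊆X , refl) = v≤max⁺ 0 (ranksWithin X)
      (inj₂ (Any.mapMaybe⁺ (rankWithin X) (subsets n)
        (Any.map⁺ (lose (∈-subsets Y) (complete y Y⊆X)))))

restrict : (Subset n → ℕ) → (I : Family n) → RankOn I
restrict r I X _ = r X

{-# OPTIONS --safe #-}

-- Iterating (CR2) enlarges a central X ⊆ Z to a central B with X ⊆ B ⊆ Z of full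
-- rank in Z.  Starting from a central subset of X ∩ Y of full rank and taking
-- Z = X ∪ Y, axiom (R3) for {B ∩ X , B ∩ Y} is submodularity of the max-rank.
-- Conversely, if adding e to a member X of a modular ideal raises the rank, then
-- e is not a loop and {X , {e}} is a modular pair, so X ∪ {e} stays in the ideal;
-- this gives (CR2), and shows that a maximum-rank member of the ideal inside X
-- already has the rank of X.

module Submission where

open import Defs
open import Data.Bool using (T)
open import Data.Fin using (Fin)
open import Data.Fin.Properties using (any?)
open import Data.Fin.Subset
  using (Subset; inside; outside; ⁅_⁆; _∈_; _⊆_; _⊂_; _∪_; _∩_; _─_; ∣_∣)
  renaming (⊥ to ∅)
open import Data.Fin.Subset.Induction using (⊂-wellFounded)
open import Data.Fin.Subset.Properties
  using ( _∈?_; x∈⁅y⁆⇒x≡y; ∣⁅x⁆∣≡1; ∣⊥∣≡0; p⊆q⇒∣p∣≤∣q∣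
        ; p∩q⊆p; p∩q⊆q; x∈p∩q⁺; p⊆p∪q; q⊆p∪q; x∈p∪q⁻; x∈p∪q⁺
        ; ∪-identityʳ; x∈p∧x∉q⇒x∈p─q; p─q⊆p; p─q─r≡p─q∪r; x∈p⇒p-x⊂p )
open import Data.Nat using (ℕ; _+_; _≤_; _<_)
open import Data.Nat.Properties
  using ( ≤-reflexive; ≤-trans; ≤-antisym; ≤⇒≯; <⇒≱; ≰⇒>; ≮⇒≥; n≤0⇒n≡0
        ; m≤m+n; +-comm; +-identityʳ; +-mono-≤; +-monoʳ-≤; +-cancelˡ-≤; +-cancelʳ-≤
        ; _≤?_; _<?_; module ≤-Reasoning )
open import Data.Product using (Σ-syntax; ∃-syntax; _×_; _,_; proj₁; proj₂)
open import Data.Sum as Sum using ([_,_]′)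
open import Data.Vec using ([]; _∷_; here; there)
open import Function using (_∘_; Inverse; Bijection)
open import Function.Properties.Inverse using (Inverse⇒Bijection)
open import Function.Structures using (IsInverse; IsBijection)
open import Induction.WellFounded using (Acc; acc)
open import Relation.Binary using (IsEquivalence)
open import Relation.Binary.PropositionalEquality
  using (_≡_; refl; sym; trans; cong; subst)
open import Relation.Nullary using (yes; no; ¬_; contradiction; _×-dec_)

private
  variable
    n : ℕ

-- Inclusions and induction on finite subsets.

∪-lub : {X Y Z : Subset n} → X ⊆ Z → Y ⊆ Z → X ∪ Y ⊆ Z
∪-lub {X = X} {Y} X⊆Z Y⊆Z = [ X⊆Z , Y⊆Z ]′ ∘ x∈p∪q⁻ X Y

∪-monoʳ : (X : Subset n) {Y Z : Subset n} → Y ⊆ Z → X ∪ Y ⊆ X ∪ Z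
∪-monoʳ X {Y} {Z} Y⊆Z = ∪-lub (p⊆p∪q Z) (q⊆p∪q X Z ∘ Y⊆Z)

∩-glb : {X Y Z : Subset n} → Z ⊆ X → Z ⊆ Y → Z ⊆ X ∩ Y
∩-glb Z⊆X Z⊆Y z = x∈p∩q⁺ (Z⊆X z , Z⊆Y z)

⁅⁆⊆ : {e : Fin n} {X : Subset n} → e ∈ X → ⁅ e ⁆ ⊆ X
⁅⁆⊆ {e = e} {X} e∈X x∈e = subst (_∈ X) (sym (x∈⁅y⁆⇒x≡y e x∈e)) e∈X

-- Builds `Y` from `∅` one element at a time, by recursion on the bit vector. The step receives
-- `e ∈ Y`, so hypotheses about elements of `Y` are available throughout.
subset-induction : (P : Subset n → Set) (Y : Subset n) → P ∅ →
  (∀ {Z e} → e ∈ Y → P Z → P (Z ∪ ⁅ e ⁆)) → P Y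
subset-induction P []            base step = base
subset-induction P (outside ∷ Y) base step =
  subset-induction (P ∘ (outside ∷_)) Y base (step ∘ there)
subset-induction P (inside ∷ Y)  base step =
  -- The first element is added last: the union of `outside ∷ Y` with that singleton reduces to
  -- `inside ∷ (Y ∪ ∅)`.
  subst (λ Z → P (inside ∷ Z)) (∪-identityʳ Y)
    (step here (subset-induction (P ∘ (outside ∷_)) Y base (step ∘ there)))

-- Augmentation for matroid rank functions.

module _ {r : Subset n → ℕ} (isRank : IsMatroidRank r) where
  open IsMatroidRank isRank
  open ≤-Reasoning

  -- Induct on the part `Z` of `Y` added so far. Submodularity for `X ∪ Z` and `X ∪ ⁅ e ⁆`, whose
  -- intersection contains `X`, shows that adding `e` still leaves the rank at most `r X`.
  rank-unaugmented : ∀ X Y → (∀ {e} → e ∈ Y → r (X ∪ ⁅ e ⁆) ≤ r X) →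
                     r (X ∪ Y) ≤ r X
  rank-unaugmented X Y stuck =
    subset-induction (λ Z → r (X ∪ Z) ≤ r X) Y
      (≤-reflexive (cong r (∪-identityʳ X))) step
    where
    step : ∀ {Z e} → e ∈ Y → r (X ∪ Z) ≤ r X → r (X ∪ (Z ∪ ⁅ e ⁆)) ≤ r X
    step {Z} {e} e∈Y rXZ≤rX = +-cancelʳ-≤ (r X) _ _ (begin
      r (X ∪ (Z ∪ ⁅ e ⁆)) + r X
        ≤⟨ +-mono-≤
             (monotone (∪-lub (p⊆p∪q _ ∘ p⊆p∪q Z)
               (∪-lub (p⊆p∪q _ ∘ q⊆p∪q X Z) (q⊆p∪q (X ∪ Z) _ ∘ q⊆p∪q X ⁅ e ⁆))))
             (monotone (∩-glb (p⊆p∪q Z) (p⊆p∪q ⁅ e ⁆))) ⟩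
      r ((X ∪ Z) ∪ (X ∪ ⁅ e ⁆)) + r ((X ∪ Z) ∩ (X ∪ ⁅ e ⁆))
        ≤⟨ submodular (X ∪ Z) (X ∪ ⁅ e ⁆) ⟩
      r (X ∪ Z) + r (X ∪ ⁅ e ⁆)
        ≤⟨ +-mono-≤ rXZ≤rX (stuck e∈Y) ⟩
      r X + r X ∎)

  -- The contrapositive of `rank-unaugmented`; a decidable search over the finite ground set
  -- produces the witness.
  augment : ∀ X Y → r X < r Y → ∃[ e ] (e ∈ Y × r X < r (X ∪ ⁅ e ⁆))
  augment X Y rX<rY with any? (λ e → e ∈? Y ×-dec r X <? r (X ∪ ⁅ e ⁆))
  ... | yes p = p
  ... | no ¬p = contradiction rX<rY (≤⇒≯ (≤-trans (monotone (q⊆p∪q X Y))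
    (rank-unaugmented X Y (λ e∈Y → ≮⇒≥ (λ lt → ¬p (_ , e∈Y , lt))))))

-- From modular ideals to semimatroids.

module _ (M : Matroid n) (I : Family n) (isIdeal : IsModularIdeal M I) where
  open Matroid M renaming (rank to r)
  open IsModularIdeal isIdeal
  open ≤-Reasoning

  ideal-augment : ∀ {X e} → X ∈ᶠ I → r X < r (X ∪ ⁅ e ⁆) → X ∪ ⁅ e ⁆ ∈ᶠ I
  ideal-augment {X} {e} x rX<rXe = MI3 modular x (MI2 nonloop)
    where
    nonloop : ¬ IsLoop M e
    nonloop re≡0 = <⇒≱ rX<rXe (begin
      r (X ∪ ⁅ e ⁆)                   ≤⟨ m≤m+n _ _ ⟩
      r (X ∪ ⁅ e ⁆) + r (X ∩ ⁅ e ⁆)   ≤⟨ submodular X ⁅ e ⁆ ⟩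
      r X + r ⁅ e ⁆                   ≡⟨ cong (r X +_) re≡0 ⟩
      r X + 0                         ≡⟨ +-identityʳ (r X) ⟩
      r X                             ∎)

    modular : IsModularPair M X ⁅ e ⁆
    -- A singleton has rank at most 1, while the strict increase gives at least `1 + r X` on the
    -- other side; submodularity is the reverse inequality.
    modular = ≤-antisym (begin
      r X + r ⁅ e ⁆                   ≤⟨ +-monoʳ-≤ (r X) (bounded ⁅ e ⁆) ⟩
      r X + ∣ ⁅ e ⁆ ∣                 ≡⟨ cong (r X +_) (∣⁅x⁆∣≡1 e) ⟩
      r X + 1                         ≡⟨ +-comm (r X) 1 ⟩
      1 + r X                         ≤⟨ rX<rXe ⟩
      r (X ∪ ⁅ e ⁆)                   ≤⟨ m≤m+n _ _ ⟩
      r (X ∪ ⁅ e ⁆) + r (X ∩ ⁅ e ⁆)   ∎)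
      (submodular X ⁅ e ⁆)

  restrict-isSemimatroid : IsSemimatroid I (restrict r I)
  restrict-isSemimatroid = record
    { nonEmpty          = nonEmpty
    ; simplicialComplex = MI1
    ; R1                = λ {X} _ → bounded X
    ; R2                = λ _ _ → monotone
    ; R3                = λ {X} {Y} _ _ _ _ → submodular X Y
    ; CR1               = CR1
    ; CR2               = CR2
    }
    where
    CR1 : ∀ {X Y} → X ∈ᶠ I → Y ∈ᶠ I → X ∩ Y ∈ᶠ I → r X ≡ r (X ∩ Y) → X ∪ Y ∈ᶠ I
    -- The hypothesis together with `r Y ≤ r (X ∪ Y)` reverses submodularity, so the pair is modular
    -- and (MI3) applies.
    CR1 {X} {Y} x y _ rX≡rX∩Y = MI3 (≤-antisym (begin
      r X + r Y               ≡⟨ +-comm (r X) (r Y) ⟩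
      r Y + r X               ≤⟨ +-mono-≤ (monotone (q⊆p∪q X Y)) (≤-reflexive rX≡rX∩Y) ⟩
      r (X ∪ Y) + r (X ∩ Y)   ∎)
      (submodular X Y)) x y

    CR2 : ∀ {X Y} → X ∈ᶠ I → Y ∈ᶠ I → r X < r Y →
          ∃[ e ] (e ∈ Y ─ X × X ∪ ⁅ e ⁆ ∈ᶠ I)
    CR2 {X} {Y} x _ rX<rY with augment isMatroidRank X Y rX<rY
    ... | e , e∈Y , rX<rXe = e , x∈p∧x∉q⇒x∈p─q e∈Y e∉X , ideal-augment x rX<rXe
      where
      e∉X : ¬ (e ∈ X)
      e∉X e∈X = <⇒≱ rX<rXe (monotone (∪-lub (λ z → z) (⁅⁆⊆ e∈X)))

-- From semimatroids to matroids with modular ideals.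

module _ (A : Semimatroid n) where
  open Semimatroid A renaming (rank to r)
  open ≤-Reasoning

  maxRank-attained : ∀ X → IsRankWithin A X (maxRank A X)
  maxRank-attained X = proj₁ (maxRank-isMaximum A X)

  rank≤maxRank : ∀ {X Y} (y : Y ∈ᶠ central) → Y ⊆ X → r Y y ≤ maxRank A X
  rank≤maxRank {X} {Y} y Y⊆X = proj₂ (maxRank-isMaximum A X) _ (Y , y , Y⊆X , refl)

  -- `X` itself competes for the maximum, and (R2) bounds every competitor by it.
  maxRank-central : ∀ {X} (x : X ∈ᶠ central) → maxRank A X ≡ r X x
  maxRank-central {X} x with maxRank-attained X
  ... | Y , y , Y⊆X , eq =
    ≤-antisym (≤-trans (≤-reflexive eq) (R2 y x Y⊆X)) (rank≤maxRank x (λ z → z))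

  -- Each use of (CR2) against the fixed target `D` moves one element of `D ─ X` into `X`, so the
  -- recursion descends along strict inclusion of `D ─ X`.
  extend-central : ∀ {X D} (x : X ∈ᶠ central) (d : D ∈ᶠ central) →
    ∃[ B ] Σ[ b ∈ B ∈ᶠ central ] (X ⊆ B × B ⊆ X ∪ D × r D d ≤ r B b)
  extend-central {D = D} x d = go x (⊂-wellFounded _)
    where
    go : ∀ {X} (x : X ∈ᶠ central) → Acc _⊂_ (D ─ X) →
      ∃[ B ] Σ[ b ∈ B ∈ᶠ central ] (X ⊆ B × B ⊆ X ∪ D × r D d ≤ r B b)
    go {X} x (acc rs) with r D d ≤? r X x
    ... | yes rD≤rX = X , x , (λ z → z) , p⊆p∪q D , rD≤rX
    ... | no  rD≰rX with CR2 x d (≰⇒> rD≰rX)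
    ... | e , e∈D─X , xe
      -- Removing `e` from `D ─ X` gives `D ─ (X ∪ ⁅ e ⁆)`, a strict subset because `e ∈ D ─ X`.
      with go xe (rs (subst (_⊂ D ─ X) (p─q─r≡p─q∪r D X ⁅ e ⁆) (x∈p⇒p-x⊂p e∈D─X)))
    ... | B , b , Xe⊆B , B⊆XeD , rD≤rB =
      B , b , Xe⊆B ∘ p⊆p∪q ⁅ e ⁆ ,
      ∪-lub (∪-monoʳ X (⁅⁆⊆ (p─q⊆p D X e∈D─X))) (q⊆p∪q X D) ∘ B⊆XeD , rD≤rB

  -- The target is a central `D ⊆ Z` attaining the maximum; the extension stays inside `X ∪ D`,
  -- hence inside `Z`.
  extend-to-maxRank : ∀ {X Z} (x : X ∈ᶠ central) → X ⊆ Z →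
    ∃[ B ] Σ[ b ∈ B ∈ᶠ central ] (X ⊆ B × B ⊆ Z × maxRank A Z ≤ r B b)
  extend-to-maxRank {X} {Z} x X⊆Z with maxRank-attained Z
  ... | D , d , D⊆Z , eq with extend-central x d
  ... | B , b , X⊆B , B⊆XD , rD≤rB =
    B , b , X⊆B , ∪-lub X⊆Z D⊆Z ∘ B⊆XD , ≤-trans (≤-reflexive eq) rD≤rB

  maxRank-isMatroidRank : IsMatroidRank (maxRank A)
  maxRank-isMatroidRank = record
    { bounded    = bounded
    ; monotone   = monotone
    ; submodular = submodular
    }
    where
    ρ : Subset n → ℕ
    ρ = maxRank A

    bounded : ∀ X → ρ X ≤ ∣ X ∣
    bounded X with maxRank-attained X
    ... | Y , y , Y⊆X , eq =
      ≤-trans (≤-reflexive eq) (≤-trans (R1 y) (p⊆q⇒∣p∣≤∣q∣ Y⊆X))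

    monotone : ∀ {X Y} → X ⊆ Y → ρ X ≤ ρ Y
    monotone {X} X⊆Y with maxRank-attained X
    ... | Z , z , Z⊆X , eq = ≤-trans (≤-reflexive eq) (rank≤maxRank z (X⊆Y ∘ Z⊆X))

    submodular : ∀ X Y → ρ (X ∪ Y) + ρ (X ∩ Y) ≤ ρ X + ρ Y
    submodular X Y with maxRank-attained (X ∩ Y)
    ... | D , d , D⊆X∩Y , eq
      with extend-to-maxRank {Z = X ∪ Y} d (p⊆p∪q Y ∘ p∩q⊆p X Y ∘ D⊆X∩Y)
    ... | B , b , D⊆B , B⊆X∪Y , ρ≤rB = begin
      ρ (X ∪ Y) + ρ (X ∩ Y)
        ≤⟨ +-mono-≤ ρ≤rB (≤-reflexive eq) ⟩
      r B b + r D d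
        -- `B ⊆ X ∪ Y` is covered by its traces on `X` and `Y`, and `D` lies in both traces. All
        -- sets involved are contained in `B`, hence central.
        ≤⟨ +-mono-≤ (R2 b u B⊆U) (R2 d i D⊆I) ⟩
      r ((B ∩ X) ∪ (B ∩ Y)) u + r ((B ∩ X) ∩ (B ∩ Y)) i
        ≤⟨ R3 bx by u i ⟩
      r (B ∩ X) bx + r (B ∩ Y) by
        ≤⟨ +-mono-≤ (rank≤maxRank bx (p∩q⊆q B X)) (rank≤maxRank by (p∩q⊆q B Y)) ⟩
      ρ X + ρ Y ∎
      where
      bx : B ∩ X ∈ᶠ central
      bx = simplicialComplex (p∩q⊆p B X) b

      by : B ∩ Y ∈ᶠ central
      by = simplicialComplex (p∩q⊆p B Y) b

      u : (B ∩ X) ∪ (B ∩ Y) ∈ᶠ central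
      u = simplicialComplex (∪-lub (p∩q⊆p B X) (p∩q⊆p B Y)) b

      i : (B ∩ X) ∩ (B ∩ Y) ∈ᶠ central
      i = simplicialComplex (p∩q⊆p B X ∘ p∩q⊆p (B ∩ X) (B ∩ Y)) b

      B⊆U : B ⊆ (B ∩ X) ∪ (B ∩ Y)
      B⊆U z = x∈p∪q⁺ (Sum.map (λ zX → x∈p∩q⁺ (z , zX)) (λ zY → x∈p∩q⁺ (z , zY))
                       (x∈p∪q⁻ X Y (B⊆X∪Y z)))

      D⊆I : D ⊆ (B ∩ X) ∩ (B ∩ Y)
      D⊆I = ∩-glb (∩-glb D⊆B (p∩q⊆p X Y ∘ D⊆X∩Y)) (∩-glb D⊆B (p∩q⊆q X Y ∘ D⊆X∩Y))

  associatedMatroid : Matroid n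
  associatedMatroid = mkMatroid (maxRank A) maxRank-isMatroidRank

  central-isModularIdeal : IsModularIdeal associatedMatroid central
  central-isModularIdeal = record
    { nonEmpty = nonEmpty
    ; MI1      = simplicialComplex
    ; MI2      = MI2
    ; MI3      = MI3
    }
    where
    MI2 : ∀ {a} → ¬ IsLoop associatedMatroid a → ⁅ a ⁆ ∈ᶠ central
    MI2 {a} nonloop with maxRank-attained ⁅ a ⁆
    ... | Y , y , Y⊆a , eq with a ∈? Y
    ... | yes a∈Y = simplicialComplex (⁅⁆⊆ a∈Y) y
    -- Here `Y` is empty, so the maximum is 0 and `a` would be a loop.
    ... | no  a∉Y = contradiction (n≤0⇒n≡0 (begin
      maxRank A ⁅ a ⁆   ≡⟨ eq ⟩
      r Y y             ≤⟨ R1 y ⟩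
      ∣ Y ∣             ≤⟨ p⊆q⇒∣p∣≤∣q∣ Y⊆∅ ⟩
      ∣ ∅ {n} ∣         ≡⟨ ∣⊥∣≡0 n ⟩
      0                 ∎)) nonloop
      where
      Y⊆∅ : Y ⊆ ∅
      Y⊆∅ z = contradiction (subst (_∈ Y) (x∈⁅y⁆⇒x≡y a (Y⊆a z)) z) a∉Y

    -- For a central B with X ⊆ B ⊆ X ∪ Y of full rank, modularity and R3 for
    -- {X , Y ∩ B} force r (Y ∩ B) = r Y, so that CR1 makes Y ∪ B = X ∪ Y central.
    MI3 : ∀ {X Y} → IsModularPair associatedMatroid X Y →
          X ∈ᶠ central → Y ∈ᶠ central → X ∪ Y ∈ᶠ central
    MI3 {X} {Y} modular x y with extend-to-maxRank {Z = X ∪ Y} x (p⊆p∪q Y)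
    ... | B , b , X⊆B , B⊆X∪Y , ρ≤rB =
      simplicialComplex (∪-lub (q⊆p∪q Y B ∘ X⊆B) (p⊆p∪q B))
        (CR1 y b yb (≤-antisym rY≤rYB (R2 yb y (p∩q⊆p Y B))))
      where
      yb : Y ∩ B ∈ᶠ central
      yb = simplicialComplex (p∩q⊆p Y B) y

      u : X ∪ (Y ∩ B) ∈ᶠ central
      u = simplicialComplex (∪-lub X⊆B (p∩q⊆q Y B)) b

      i : X ∩ (Y ∩ B) ∈ᶠ central
      i = simplicialComplex (p∩q⊆p X (Y ∩ B)) x

      B⊆U : B ⊆ X ∪ (Y ∩ B)
      B⊆U z = x∈p∪q⁺ (Sum.map₂ (λ zY → x∈p∩q⁺ (zY , z)) (x∈p∪q⁻ X Y (B⊆X∪Y z)))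

      xy : X ∩ Y ∈ᶠ central
      xy = simplicialComplex (p∩q⊆p X Y) x

      X∩Y⊆I : X ∩ Y ⊆ X ∩ (Y ∩ B)
      X∩Y⊆I = ∩-glb (p∩q⊆p X Y) (∩-glb (p∩q⊆q X Y) (X⊆B ∘ p∩q⊆p X Y))

      rY≤rYB : r Y y ≤ r (Y ∩ B) yb
      rY≤rYB = +-cancelˡ-≤ (r X x) _ _ (begin
        r X x + r Y y
          ≤⟨ +-mono-≤ (rank≤maxRank x (λ z → z)) (rank≤maxRank y (λ z → z)) ⟩
        maxRank A X + maxRank A Y
          ≡⟨ modular ⟩
        maxRank A (X ∪ Y) + maxRank A (X ∩ Y)
          ≤⟨ +-mono-≤ ρ≤rB (≤-reflexive (maxRank-central xy)) ⟩
        r B b + r (X ∩ Y) xy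
          ≤⟨ +-mono-≤ (R2 b u B⊆U) (R2 xy i X∩Y⊆I) ⟩
        r (X ∪ (Y ∩ B)) u + r (X ∩ (Y ∩ B)) i
          ≤⟨ R3 x yb u i ⟩
        r X x + r (Y ∩ B) yb ∎)

-- The two constructions are mutually inverse.

maxRank-mono-≈ : {A B : Semimatroid n} → A ≈ˢ B → ∀ X → maxRank A X ≤ maxRank B X
maxRank-mono-≈ {A = A} {B} A≈B X with maxRank-attained A X
... | Y , y , Y⊆X , eq =
  ≤-trans (≤-reflexive (trans eq (_≈ˢ_.rank≡ A≈B Y y y′))) (rank≤maxRank B y′ Y⊆X)
  where
  y′ : Y ∈ᶠ Semimatroid.central B
  y′ = subst T (_≈ˢ_.central≡ A≈B Y) y

maxRank-cong : {A B : Semimatroid n} → A ≈ˢ B → ∀ X → maxRank A X ≡ maxRank B X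
maxRank-cong A≈B X = ≤-antisym (maxRank-mono-≈ A≈B X)
  (maxRank-mono-≈ (IsEquivalence.sym ≈ˢ-isEquivalence A≈B) X)

toMatId : Semimatroid n → MatId n
toMatId A = mkMatId (associatedMatroid A) (Semimatroid.central A) (central-isModularIdeal A)

toSemimatroid : MatId n → Semimatroid n
toSemimatroid (mkMatId M I isIdeal) =
  mkSemimatroid I (restrict (Matroid.rank M) I) (restrict-isSemimatroid M I isIdeal)

maxRank-toSemimatroid : (P : MatId n) → ∀ X →
  maxRank (toSemimatroid P) X ≡ Matroid.rank (MatId.matroid P) X
maxRank-toSemimatroid P@(mkMatId M I isIdeal) X
  with maxRank-attained (toSemimatroid P) X
... | Y , y , Y⊆X , eq =
  ≤-antisym (≤-trans (≤-reflexive eq) (monotone Y⊆X)) (≮⇒≥ not-below)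
  where
  open Matroid M

  not-below : ¬ (maxRank (toSemimatroid P) X < rank X)
  -- Augmenting the maximizer `Y` from `X` yields a member of the ideal, still inside `X`, whose
  -- rank exceeds the maximum.
  not-below ρX<rX with augment isMatroidRank Y X (subst (_< rank X) eq ρX<rX)
  ... | e , e∈X , rY<rYe = <⇒≱ rY<rYe (≤-trans
    (rank≤maxRank (toSemimatroid P) (ideal-augment M I isIdeal y rY<rYe)
      (∪-lub Y⊆X (⁅⁆⊆ e∈X)))
    (≤-reflexive eq))

-- Both maps keep the family of sets unchanged, so each round trip comes down to comparing rank
-- functions: `maxRank-toSemimatroid` on one side, `maxRank-central` on the other.
semimatroid↔matId : ∀ n → Inverse
  (record { isEquivalence = ≈ˢ-isEquivalence {n} })
  (record { isEquivalence = ≈ᵐ-isEquivalence {n} })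
semimatroid↔matId n = record
  { to        = toMatId
  ; from      = toSemimatroid
  ; to-cong   = to-cong
  ; from-cong = from-cong
  ; inverse   = (λ {P} {A} A≈ → IsEquivalence.trans ≈ᵐ-isEquivalence
                   (to-cong A≈) (to∘from P))
              , (λ {A} {P} P≈ → IsEquivalence.trans ≈ˢ-isEquivalence
                   (from-cong P≈) (from∘to A))
  }
  where
  to-cong : {A B : Semimatroid n} → A ≈ˢ B → toMatId A ≈ᵐ toMatId B
  to-cong A≈B = record { rank≡ = maxRank-cong A≈B ; ideal≡ = _≈ˢ_.central≡ A≈B }

  from-cong : {P Q : MatId n} → P ≈ᵐ Q → toSemimatroid P ≈ˢ toSemimatroid Q
  from-cong P≈Q = record
    { central≡ = _≈ᵐ_.ideal≡ P≈Q ; rank≡ = λ X _ _ → _≈ᵐ_.rank≡ P≈Q X }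

  to∘from : ∀ P → toMatId (toSemimatroid P) ≈ᵐ P
  to∘from P = record { rank≡ = maxRank-toSemimatroid P ; ideal≡ = λ _ → refl }

  from∘to : ∀ A → toSemimatroid (toMatId A) ≈ˢ A
  from∘to A = record { central≡ = λ _ → refl ; rank≡ = λ _ _ → maxRank-central A }

theorem3p6 : (n : ℕ) →
    Σ[ part₁ ∈ ((A : Semimatroid n) →
                Σ[ isRank ∈ IsMatroidRank (maxRank A) ]
                  IsModularIdeal (mkMatroid (maxRank A) isRank) (Semimatroid.central A)) ]
    Σ[ part₂ ∈ ((M : Matroid n) (I : Family n) → IsModularIdeal M I →
                IsSemimatroid I (restrict (Matroid.rank M) I)) ]
      (let
         Φ : Semimatroid n → MatId n
         Φ A = mkMatId (mkMatroid (maxRank A) (proj₁ (part₁ A)))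
                       (Semimatroid.central A) (proj₂ (part₁ A))
         Ψ : MatId n → Semimatroid n
         Ψ (mkMatId M I isIdeal) =
           mkSemimatroid I (restrict (Matroid.rank M) I) (part₂ M I isIdeal)
       in IsInverse _≈ˢ_ _≈ᵐ_ Φ Ψ × IsBijection _≈ˢ_ _≈ᵐ_ Φ)
theorem3p6 n =
    (λ A → maxRank-isMatroidRank A , central-isModularIdeal A)
  , restrict-isSemimatroid
  -- With the two parts above filled in, `Φ` and `Ψ` are definitionally `toMatId` and
  -- `toSemimatroid`.
  , Inverse.isInverse (semimatroid↔matId n)
  , Bijection.isBijection (Inverse⇒Bijection (semimatroid↔matId n))
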